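{- Let $\tilde L$ be a minimum-size counterexample. Then every join-irreducible element $j$ of $\tilde L$ satisfies $|{\uparrow}j|>\ell(\tilde L)$.
   Context: The length $\ell(L)$ of a finite lattice $L$ is one less than the maximum number of elements of a chain (totally ordered subset) in $L$. For a poset $P$, $x$ upper covers $y$ if $y<x$ with nothing strictly between; join-irreducible: upper covers exactly one element. For $x\in P$, ${\uparrow}x=\{y: x\le y\}$. A counterexample is a finite lattice $L$ with $|L|>1$ in which every join-irreducible $j$ satisfies $|{\uparrow}j|>|L|/2$; a minimum-size counterexample is a counterexample $\tilde L$ such that no counterexample has fewer elements. -}

module Defs where

open import Data.Fin.Base using (Fin)
open import Data.Fin.Properties using (inj⇒≟)
open import Data.Fin.Subset using (Subset; inside; outside; Lift; ∣_∣)
open import Data.Fin.Subset.Properties using (Lift?)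
open import Data.List.Base using (List; _++_; [_]; map; filter)
open import Data.List.Extrema.Nat using (max)
open import Data.Nat.Base using (ℕ; zero; suc; _*_; pred; _<_; _>_)
open import Data.Product using (_×_; ∃; ∃!)
open import Data.Sum.Base using (_⊎_)
open import Data.Vec.Base as Vec using (tabulate)
open import Function.Bundles using (Inverse)
open import Function.Properties.Inverse using (Inverse⇒Injection)
import Function.Construct.Symmetry as Symmetry
open import Level using (0ℓ)
open import Relation.Binary.Definitions using (Decidable)
open import Relation.Binary.Lattice using (Lattice)
open import Relation.Binary.Lattice.Properties.JoinSemilattice using (≈-dec⇒≤-dec)
import Relation.Binary.Properties.Poset as PosetProperties
import Relation.Binary.PropositionalEquality.Properties as ≡
open import Relation.Nullary.Decidable using (does; _⊎-dec_)
open import Relation.Nullary.Negation using (¬_)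
import Relation.Unary as Unary

-- Lists every subset of Fin n exactly once.
subsets : ∀ n → List (Subset n)
subsets zero    = [ Vec.[] ]
subsets (suc n) = map (outside Vec.∷_) (subsets n) ++ map (inside Vec.∷_) (subsets n)

-- The enumeration is a bijection onto the carrier modulo _≈_, so size is
-- the number of elements, and a Subset size is a set of lattice elements
-- given by their indices.
record FiniteLattice : Set₁ where
  field
    lattice     : Lattice 0ℓ 0ℓ 0ℓ
    size        : ℕ
    enumeration : Inverse (≡.setoid (Fin size)) (Lattice.setoid lattice)

  open Lattice lattice public
  open PosetProperties poset public using () renaming (_<_ to _≺_)

  element : Fin size → Carrier
  element = Inverse.to enumeration

  infix 4 _≟_ _≤?_

  _≟_ : Decidable _≈_
  _≟_ = inj⇒≟ (Inverse⇒Injection (Symmetry.inverse enumeration))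

  -- The order is decidable without assuming so, since x ≤ y iff x ∨ y ≈ y.
  _≤?_ : Decidable _≤_
  _≤?_ = ≈-dec⇒≤-dec joinSemilattice _≟_

  -- Read "x upper covers y".
  _UpperCovers_ : Carrier → Carrier → Set
  x UpperCovers y = y ≺ x × ¬ ∃ λ z → y ≺ z × z ≺ x

  JoinIrreducible : Carrier → Set
  JoinIrreducible j = ∃! _≈_ λ y → j UpperCovers y

  ↑_ : Carrier → Subset size
  ↑ x = tabulate λ i → does (x ≤? element i)

  Comparable : Carrier → Carrier → Set
  Comparable x y = x ≤ y ⊎ y ≤ x

  comparable? : Decidable Comparable
  comparable? x y = (x ≤? y) ⊎-dec (y ≤? x)

  IsChain : Subset size → Set
  IsChain C = Lift (λ i → Lift (λ k → Comparable (element i) (element k)) C) C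

  isChain? : Unary.Decidable IsChain
  isChain? C = Lift? (λ i → Lift? (λ k → comparable? (element i) (element k)) C) C

  -- The empty subset is a chain, so the default 0 never alters the maximum.
  length : ℕ
  length = pred (max 0 (map ∣_∣ (filter isChain? (subsets size))))

open FiniteLattice

-- The bound |↑ j| > |L| / 2 is written with the denominator cleared.
IsCounterexample : FiniteLattice → Set
IsCounterexample L =
  size L > 1 × (∀ j → JoinIrreducible L j → 2 * ∣ ↑_ L j ∣ > size L)

IsMinimumSizeCounterexample : FiniteLattice → Set₁
IsMinimumSizeCounterexample L =
  IsCounterexample L × (∀ K → IsCounterexample K → ¬ size K < size L)

{-# OPTIONS --safe #-}

-- A chain C that attains the length ℓ has a greatest element c and, if
-- ℓ > 0, a second greatest element m.  A minimal element j of
-- { x : x ≰ m } is join-irreducible, since every y < j lies below j ∧ m.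
-- Of C, ↑ j contains at most c, so |↑ j| ≤ |L| - ℓ; as |↑ j| > |L| / 2, this
-- gives ℓ < |L| / 2, which is less than |↑ i| for each join-irreducible i.
module Submission where

open import Defs
open import Data.Fin.Base using (Fin)
open import Data.Fin.Induction using (po-wellFounded; po-noetherian)
open import Data.Fin.Properties using (any?)
open import Data.Fin.Subset using
  (Subset; inside; outside; ∣_∣; _∈_; _⊆_; _∩_; _∪_; ∁; ⁅_⁆; Nonempty)
open import Data.Fin.Subset.Properties using
  ( _∈?_; nonempty?; Empty-unique; x∈⁅x⁆; p⊆q⇒∣p∣≤∣q∣; ∣⊥∣≡0; ∣⁅x⁆∣≡1; ∣∁p∣≡n∸∣p∣
  ; x∉p⇒x∈∁p; x∈∁p⇒x∉p; p∩q⊆p; p∩q⊆q; x∈p∩q⁺; x∈p∪q⁺ )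
import Data.List.Relation.Unary.All as All
open import Data.List.Extrema.Nat using (max≤v⁺)
open import Data.List.Relation.Unary.All.Properties using (all-filter; map⁺)
open import Data.Nat.Base
  using (suc; _+_; _*_; _∸_; pred; _<_; _>_; z≤n; s≤s; >-nonZero)
  renaming (_≤_ to _≤ⁿ_)
import Data.Nat.Properties as ℕ
open import Data.Product.Base using (_×_; _,_; proj₁; proj₂; ∃)
open import Data.Sum.Base using (inj₁; inj₂)
open import Data.Vec.Base using (_∷_; [])
open import Data.Vec.Properties using ([]=⇒lookup; lookup∘tabulate)
open import Function.Base using (_∘_; case_of_)
open import Function.Bundles using (Inverse; Injection)
open import Function.Properties.Inverse using (Inverse⇒Injection)
open import Induction.WellFounded using (WellFounded; Acc; acc)
open import Level using (0ℓ)
open import Relation.Binary.Core using (Rel)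
open import Relation.Binary.Definitions using (Decidable)
import Relation.Binary.Construct.On as On
open import Relation.Binary.PropositionalEquality using (_≡_; sym; trans; cong; subst)
open import Relation.Nullary.Decidable
  using (does; yes; no; ¬?; _×-dec_; decidable-stable)
open import Relation.Nullary.Negation using (¬_)
import Relation.Binary.Properties.Poset as PosetProperties
import Relation.Unary as Unary

∣p∪q∣≤∣p∣+∣q∣ : ∀ {n} (p q : Subset n) → ∣ p ∪ q ∣ ≤ⁿ ∣ p ∣ + ∣ q ∣
∣p∪q∣≤∣p∣+∣q∣ []            []            = z≤n
∣p∪q∣≤∣p∣+∣q∣ (outside ∷ p) (outside ∷ q) = ∣p∪q∣≤∣p∣+∣q∣ p q
∣p∪q∣≤∣p∣+∣q∣ (outside ∷ p) (inside  ∷ q) = begin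
  suc ∣ p ∪ q ∣          ≤⟨ s≤s (∣p∪q∣≤∣p∣+∣q∣ p q) ⟩
  suc (∣ p ∣ + ∣ q ∣)    ≡⟨ ℕ.+-suc ∣ p ∣ ∣ q ∣ ⟨
  ∣ p ∣ + suc ∣ q ∣      ∎
  where open ℕ.≤-Reasoning
∣p∪q∣≤∣p∣+∣q∣ (inside  ∷ p) (outside ∷ q) = s≤s (∣p∪q∣≤∣p∣+∣q∣ p q)
∣p∪q∣≤∣p∣+∣q∣ (inside  ∷ p) (inside  ∷ q) =
  s≤s (ℕ.≤-trans (∣p∪q∣≤∣p∣+∣q∣ p q) (ℕ.+-monoʳ-≤ ∣ p ∣ (ℕ.n≤1+n ∣ q ∣)))

-- Descent: while some `l ⊏ i` satisfies `P`, move to it; well-foundedness ends the search. With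
-- `_⊏_` arbitrary, the reversed order yields maximal elements.
∃-minimal : ∀ {n} {_⊏_ : Rel (Fin n) 0ℓ} {P : Unary.Pred (Fin n) 0ℓ} →
            WellFounded _⊏_ → Decidable _⊏_ → Unary.Decidable P →
            ∀ {i} → P i → ∃ λ k → P k × (∀ l → l ⊏ k → ¬ P l)
∃-minimal {_⊏_ = _⊏_} {P} wf _⊏?_ P? = go (wf _)
  where
  go : ∀ {i} → Acc _⊏_ i → P i → ∃ λ k → P k × (∀ l → l ⊏ k → ¬ P l)
  go {i} (acc rs) Pi with any? (λ l → (l ⊏? i) ×-dec P? l)
  ... | yes (l , l⊏i , Pl) = go (rs l⊏i) Pl
  ... | no  ∄l             = i , Pi , λ l l⊏i Pl → ∄l (l , l⊏i , Pl)

-- The complement of more than half is less than half: adding the hypotheses gives `n < a + b`.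
-- Truncated subtraction also needs `b` nonzero, which `n < 2 * b` forces.
n<2a∧n<2b⇒n∸a<b : ∀ {n} a b → n < 2 * a → n < 2 * b → n ∸ a < b
n<2a∧n<2b⇒n∸a<b {n} a b@(suc _) n<2a n<2b =
  ℕ.m<n+o⇒m∸n<o n a (ℕ.*-cancelˡ-< 2 n (a + b) (begin-strict
    2 * n          ≡⟨ cong (n +_) (ℕ.+-identityʳ n) ⟩
    n + n          <⟨ ℕ.+-mono-< n<2a n<2b ⟩
    2 * a + 2 * b  ≡⟨ ℕ.*-distribˡ-+ 2 a b ⟨
    2 * (a + b)    ∎))
  where open ℕ.≤-Reasoning

module _ (L : FiniteLattice) where
  open FiniteLattice L renaming (trans to ≤-trans)
  open PosetProperties poset using (<⇒≱; <-respˡ-≈)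

  private
    index : Carrier → Fin size
    index = Inverse.from enumeration

    element-index : ∀ x → element (index x) ≈ x
    element-index = Inverse.strictlyInverseˡ enumeration

    element-injective : ∀ {i k} → element i ≈ element k → i ≡ k
    element-injective = Injection.injective (Inverse⇒Injection enumeration)

  _≺?_ : Decidable _≺_
  x ≺? y = (x ≤? y) ×-dec ¬? (x ≟ y)

  ∈↑⇒≤ : ∀ {x k} → k ∈ ↑ x → x ≤ element k
  ∈↑⇒≤ {x} {k} k∈↑x
    -- Abstracting the decision together with the equation that its `does` is `inside` makes the
    -- `no` case absurd.
    with x ≤? element k
       | trans (sym (lookup∘tabulate (λ i → does (x ≤? element i)) k)) ([]=⇒lookup k∈↑x)
  ... | yes x≤k | _ = x≤k

  -- `j ∧ m` is the greatest of the elements strictly below `j`, so `j` covers it and can cover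
  -- nothing else.
  minimal-≰⇒joinIrreducible : ∀ {j m} → ¬ j ≤ m → (∀ y → y ≺ j → y ≤ m) →
                              JoinIrreducible j
  minimal-≰⇒joinIrreducible {j} {m} j≰m below =
    j ∧ m , (j∧m≺j , nothing-between) , unique
    where
    j∧m≺j : j ∧ m ≺ j
    j∧m≺j = x∧y≤x j m , λ j∧m≈j → j≰m (≤-trans (reflexive (Eq.sym j∧m≈j)) (x∧y≤y j m))

    ≺j⇒≤j∧m : ∀ {y} → y ≺ j → y ≤ j ∧ m
    ≺j⇒≤j∧m y≺j = ∧-greatest (proj₁ y≺j) (below _ y≺j)

    nothing-between : ¬ ∃ λ z → j ∧ m ≺ z × z ≺ j
    nothing-between (z , (j∧m≤z , j∧m≉z) , z≺j) = j∧m≉z (antisym j∧m≤z (≺j⇒≤j∧m z≺j))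

    unique : ∀ {y} → j UpperCovers y → j ∧ m ≈ y
    unique {y} (y≺j , ∄between) = decidable-stable (j ∧ m ≟ y) λ j∧m≉y →
      ∄between (j ∧ m , (≺j⇒≤j∧m y≺j , j∧m≉y ∘ Eq.sym) , j∧m≺j)

  ∃-joinIrreducible-≰ : ∀ {x m} → ¬ x ≤ m → ∃ λ j → JoinIrreducible j × ¬ j ≤ m
  ∃-joinIrreducible-≰ {x} {m} x≰m =
    let k , k≰m , minimal = ∃-minimal
          (po-wellFounded (On.isPartialOrder element isPartialOrder))
          (λ i l → element i ≺? element l) (λ i → ¬? (element i ≤? m))
          {index x} (λ ix≤m → x≰m (≤-respˡ-≈ (element-index x) ix≤m))
        -- `minimal` speaks of indices, so `y` is replaced by `element (index y)` and the result
        -- carried back along `≈`.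
        below y y≺k = ≤-respˡ-≈ (element-index y)
          (decidable-stable (element (index y) ≤? m)
            (minimal (index y) (<-respˡ-≈ (Eq.sym (element-index y)) y≺k)))
    in element k , minimal-≰⇒joinIrreducible k≰m below , k≰m

  IsChain-⊆ : ∀ {C D} → D ⊆ C → IsChain C → IsChain D
  IsChain-⊆ D⊆C chain i∈D k∈D = chain (D⊆C i∈D) (D⊆C k∈D)

  -- An element minimal for the reversed order is maximal in `C`, and comparability makes it
  -- greatest.
  ∃-greatest : ∀ {C} → IsChain C → Nonempty C →
               ∃ λ g → g ∈ C × (∀ {k} → k ∈ C → element k ≤ element g)
  ∃-greatest {C} chain (i , i∈C) =
    let g , g∈C , maximal = ∃-minimal
          (po-noetherian (On.isPartialOrder element isPartialOrder))
          (λ k l → element l ≺? element k) (_∈? C) i∈C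
        greatest : ∀ {k} → k ∈ C → element k ≤ element g
        greatest {k} k∈C = case chain k∈C g∈C of λ where
          (inj₁ k≤g) → k≤g
          (inj₂ g≤k) → reflexive (Eq.sym (decidable-stable (element g ≟ element k)
                         λ g≉k → maximal k (g≤k , g≉k) k∈C))
    in g , g∈C , greatest

  module _ (counterexample : IsCounterexample L) where
    private
      size<2∣↑_∣ : ∀ {j} → JoinIrreducible j → size < 2 * ∣ ↑ j ∣
      size<2∣↑_∣ = proj₂ counterexample _

    ∣↑j∣>0 : ∀ {j} → JoinIrreducible j → 0 < ∣ ↑ j ∣
    ∣↑j∣>0 {j} ji = ℕ.*-cancelˡ-< 2 0 ∣ ↑ j ∣ (ℕ.≤-<-trans z≤n size<2∣↑ ji ∣)

    -- If `m` is greatest in `C`, then `m ≺ x` gives `¬ x ≤ m`, hence a join-irreducible `i` not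
    -- below `m`, and `↑ i` misses `C`. Here `i` may differ from `j`; both up-sets exceed half of
    -- the lattice.
    ∣chain-below∣<∣↑j∣ : ∀ {j} → JoinIrreducible j →
                         ∀ {C x} → IsChain C → (∀ {k} → k ∈ C → element k ≺ x) →
                         ∣ C ∣ < ∣ ↑ j ∣
    ∣chain-below∣<∣↑j∣ {j} ji {C} chain C≺x with nonempty? C
    -- An empty `C` has no greatest element to serve as `m`; the bound is then the positivity of
    -- `∣ ↑ j ∣`.
    ... | no C≡∅ rewrite Empty-unique C≡∅ | ∣⊥∣≡0 size = ∣↑j∣>0 ji
    ... | yes C≢∅ =
      let m , m∈C , C≤m = ∃-greatest {C} chain C≢∅
          i , iji , i≰m = ∃-joinIrreducible-≰ (<⇒≱ (C≺x m∈C))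
          C⊆∁↑i : C ⊆ ∁ (↑ i)
          C⊆∁↑i k∈C = x∉p⇒x∈∁p λ k∈↑i → i≰m (≤-trans (∈↑⇒≤ k∈↑i) (C≤m k∈C))
      in begin-strict
        ∣ C ∣             ≤⟨ p⊆q⇒∣p∣≤∣q∣ C⊆∁↑i ⟩
        ∣ ∁ (↑ i) ∣       ≡⟨ ∣∁p∣≡n∸∣p∣ (↑ i) ⟩
        size ∸ ∣ ↑ i ∣    <⟨ n<2a∧n<2b⇒n∸a<b ∣ ↑ i ∣ ∣ ↑ j ∣ size<2∣↑ iji ∣ size<2∣↑ ji ∣ ⟩
        ∣ ↑ j ∣           ∎
      where open ℕ.≤-Reasoning

    -- Removing the greatest element `c` leaves a chain strictly below `c`; the strict bound on that
    -- chain leaves room to put `c` back.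
    ∣chain∣≤∣↑j∣ : ∀ {j} → JoinIrreducible j → ∀ {C} → IsChain C → ∣ C ∣ ≤ⁿ ∣ ↑ j ∣
    ∣chain∣≤∣↑j∣ {j} ji {C} chain with nonempty? C
    ... | no C≡∅ rewrite Empty-unique C≡∅ | ∣⊥∣≡0 size = z≤n
    ... | yes C≢∅ =
      let c , _ , C≤c = ∃-greatest {C} chain C≢∅
          D = C ∩ ∁ ⁅ c ⁆
          D⊆C : D ⊆ C
          D⊆C = p∩q⊆p C (∁ ⁅ c ⁆)
          D≺c : ∀ {k} → k ∈ D → element k ≺ element c
          D≺c k∈D = C≤c (D⊆C k∈D) , λ k≈c →
            x∈∁p⇒x∉p (p∩q⊆q C (∁ ⁅ c ⁆) k∈D)
              (subst (_∈ ⁅ c ⁆) (sym (element-injective k≈c)) (x∈⁅x⁆ c))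
          C⊆⁅c⁆∪D : C ⊆ ⁅ c ⁆ ∪ D
          C⊆⁅c⁆∪D {k} k∈C = x∈p∪q⁺ (case k ∈? ⁅ c ⁆ of λ where
            (yes k∈⁅c⁆) → inj₁ k∈⁅c⁆
            (no  k∉⁅c⁆) → inj₂ (x∈p∩q⁺ (k∈C , x∉p⇒x∈∁p k∉⁅c⁆)))
      in begin
        ∣ C ∣                ≤⟨ p⊆q⇒∣p∣≤∣q∣ C⊆⁅c⁆∪D ⟩
        ∣ ⁅ c ⁆ ∪ D ∣        ≤⟨ ∣p∪q∣≤∣p∣+∣q∣ ⁅ c ⁆ D ⟩
        ∣ ⁅ c ⁆ ∣ + ∣ D ∣    ≡⟨ cong (_+ ∣ D ∣) (∣⁅x⁆∣≡1 c) ⟩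
        suc ∣ D ∣            ≤⟨ ∣chain-below∣<∣↑j∣ ji {D} (IsChain-⊆ D⊆C chain) D≺c ⟩
        ∣ ↑ j ∣              ∎
      where open ℕ.≤-Reasoning

theorem2p7 : (L : FiniteLattice) → IsMinimumSizeCounterexample L →
    (let open FiniteLattice L) →
    ∀ j → JoinIrreducible j → ∣ ↑ j ∣ > length
theorem2p7 L (counterexample , _) j ji = begin-strict
  -- The inner `z≤n` bounds the default value 0 of `max`.
  length        ≤⟨ ℕ.pred-mono-≤ (max≤v⁺ z≤n (map⁺ (All.map
                     (λ {C} → ∣chain∣≤∣↑j∣ L counterexample ji {C})
                     (all-filter isChain? (subsets size))))) ⟩
  -- Length is one less than the largest chain size, which turns the weak bound into a strict one;
  -- positivity of `∣ ↑ j ∣` makes `pred` a genuine decrease.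
  pred ∣ ↑ j ∣  <⟨ ℕ.≤-reflexive (ℕ.suc-pred ∣ ↑ j ∣) ⟩
  ∣ ↑ j ∣       ∎
  where
  open FiniteLattice L using (size; isChain?; ↑_; length)
  open ℕ.≤-Reasoning
  instance _ = >-nonZero (∣↑j∣>0 L counterexample ji)
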